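{- Let $x_0$ be a primitive word over a finite alphabet $A$, and let $x_1$ be a proper prefix of $x_0$, i.e. $x_0 = x_1x_2$ with $x_1$ and $x_2$ non-empty words. Let $e_1 \geq 1$ and $e_2 \geq 1$ be integers with $e_1+e_2 \geq 3$, and let $W = x_0^{e_1}x_1x_0^{e_2}$. Let $w_1$ be the factor of $W$ of length $|x_0|$ that ends with the core of the interrupt of $W$ (its last letter is at the same position of $W$ as the last letter of the core), and let $w_2$ be the factor of $W$ of length $|x_0|$ that starts with the core of the interrupt of $W$ (its first letter is at the same position of $W$ as the first letter of the core). Then neither $w_1$ nor $w_2$ belongs to the conjugacy class $Cl(x_0)$ of $x_0$.
   Context: Words are finite sequences of letters of a finite alphabet $A$; $|w|$ is the length of $w$; multiplication of words is concatenation, and $w^n$ is the concatenation of $n$ copies of $w$. A factor of a word is a contiguous block of it. A word is primitive if it cannot be written as $y^k$ for a word $y$ and an integer $k \geq 2$. The conjugacy class is $Cl(x) = \{x\} \cup \{vu : x = uv,\ u,v \text{ non-empty}\}$. For words $x,y$, $\operatorname{lcp}(x,y)$ is their longest common prefix and $\operatorname{lcs}(x,y)$ their longest common suffix (both are words, possibly empty). Core of the interrupt: let $W = x_0^{e_1}x_1x_0^{e_2}$ with $x_0 = x_1x_2$ primitive, $x_1,x_2$ non-empty, $e_1,e_2\ge 1$, $e_1+e_2\ge 3$. Let $\tilde p$ be the prefix of $x_1x_2$ of length $|\operatorname{lcp}(x_1x_2, x_2x_1)|+1$, and let $\tilde s$ be the suffix of $x_2x_1$ of length $|\operatorname{lcs}(x_1x_2,x_2x_1)|+1$.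 The core of the interrupt of $W$ is the occurrence in $W$ of the factor $\tilde s\tilde p$ that is preceded by exactly $|x_0^{e_1}|+|x_1|-|\operatorname{lcs}(x_1x_2,x_2x_1)|-1$ letters of $W$; that is, the occurrence of $\tilde s$ is a suffix of the prefix $x_0^{e_1}x_1$ of $W$ and the occurrence of $\tilde p$ is a prefix of the remaining suffix $x_0^{e_2}$ of $W$. (It is known that, for $x_1x_2$ primitive, $|\operatorname{lcp}(x_1x_2,x_2x_1)|+|\operatorname{lcs}(x_1x_2,x_2x_1)| \leq |x_1x_2|-2$, so the core has length at most $|x_0|$.) -}

module Defs where

open import Data.Fin using (Fin)
open import Data.Fin.Properties using (inj⇒≟)
open import Data.List using (List; []; _∷_; _++_; length; take; drop; reverse; replicate; concat)
open import Data.List.Relation.Binary.Prefix.Heterogeneous using (Prefix; []; _∷_)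
open import Data.Nat using (ℕ; _+_; _∸_; _≤_)
open import Data.Product using (_×_; ∃₂)
open import Data.Sum using (_⊎_)
open import Function using (_↔_)
open import Function.Properties.Inverse using (↔⇒↣)
open import Relation.Binary.Definitions using (DecidableEquality)
open import Relation.Binary.PropositionalEquality using (_≡_; _≢_; refl; sym; trans)
open import Relation.Nullary using (yes; no; contradiction)

infixr 8 _^ʷ_
infix 4 _∈Cl_

_^ʷ_ : ∀ {a} {A : Set a} → List A → ℕ → List A
w ^ʷ n = concat (replicate n w)

Primitive : ∀ {a} {A : Set a} → List A → Set a
Primitive {A = A} w = (y : List A) (n : ℕ) → 2 ≤ n → w ≢ y ^ʷ n

_∈Cl_ : ∀ {a} {A : Set a} → List A → List A → Set a
y ∈Cl x = y ≡ x ⊎ ∃₂ λ u v → u ≢ [] × v ≢ [] × x ≡ u ++ v × y ≡ v ++ u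

prefixOfLength : ∀ {a} {A : Set a} → ℕ → List A → List A
prefixOfLength = take

suffixOfLength : ∀ {a} {A : Set a} → ℕ → List A → List A
suffixOfLength n w = drop (length w ∸ n) w

-- The factor of w of length n that is preceded by exactly i letters of w
-- (meaningful when i + n ≤ length w).
factor : ∀ {a} {A : Set a} → ℕ → ℕ → List A → List A
factor i n w = take n (drop i w)

module FiniteAlphabet {a} {A : Set a} {k : ℕ} (A↔Fin : A ↔ Fin k) where

  _≟_ : DecidableEquality A
  _≟_ = inj⇒≟ (↔⇒↣ A↔Fin)

  lcp : List A → List A → List A
  lcp []       _        = []
  lcp (_ ∷ _)  []       = []
  lcp (x ∷ xs) (y ∷ ys) with x ≟ y
  ... | yes _ = x ∷ lcp xs ys
  ... | no  _ = []

  lcs : List A → List A → List A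
  lcs x y = reverse (lcp (reverse x) (reverse y))

  lcp-prefixˡ : ∀ x y → Prefix _≡_ (lcp x y) x
  lcp-prefixˡ []       _        = []
  lcp-prefixˡ (_ ∷ _)  []       = []
  lcp-prefixˡ (x ∷ xs) (y ∷ ys) with x ≟ y
  ... | yes _ = refl ∷ lcp-prefixˡ xs ys
  ... | no  _ = []

  lcp-prefixʳ : ∀ x y → Prefix _≡_ (lcp x y) y
  lcp-prefixʳ []       _        = []
  lcp-prefixʳ (_ ∷ _)  []       = []
  lcp-prefixʳ (x ∷ xs) (y ∷ ys) with x ≟ y
  ... | yes x≡y = x≡y ∷ lcp-prefixʳ xs ys
  ... | no  _   = []

  lcp-longest : ∀ {z x y} → Prefix _≡_ z x → Prefix _≡_ z y → Prefix _≡_ z (lcp x y)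
  lcp-longest [] _ = []
  lcp-longest {x = x ∷ _} {y = y ∷ _} (z≡x ∷ p) (z≡y ∷ q) with x ≟ y
  ... | yes _   = z≡x ∷ lcp-longest p q
  ... | no  x≢y = contradiction (trans (sym z≡x) z≡y) x≢y

  -- The intended case is x₀ ≡ x₁ ++ x₂ primitive with x₁, x₂ non-empty and
  -- 1 ≤ e₁, 1 ≤ e₂.  Then |lcp| + |lcs| + 2 ≤ |x₀|, so p̃ and s̃ have exactly
  -- the prescribed lengths, no subtraction below is truncated, and w₁ and w₂
  -- lie entirely inside W.
  module Interrupt (x₀ x₁ x₂ : List A) (e₁ e₂ : ℕ) where

    W : List A
    W = x₀ ^ʷ e₁ ++ x₁ ++ x₀ ^ʷ e₂

    p̃ : List A
    p̃ = prefixOfLength (length (lcp (x₁ ++ x₂) (x₂ ++ x₁)) + 1) (x₁ ++ x₂)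

    s̃ : List A
    s̃ = suffixOfLength (length (lcs (x₁ ++ x₂) (x₂ ++ x₁)) + 1) (x₂ ++ x₁)

    core : List A
    core = s̃ ++ p̃

    -- The core is an occurrence in W, not just a word: it occupies the
    -- positions from coreStart (inclusive, counted from 0) to coreEnd
    -- (exclusive).
    coreStart : ℕ
    coreStart = length (x₀ ^ʷ e₁) + length x₁ ∸ length (lcs (x₁ ++ x₂) (x₂ ++ x₁)) ∸ 1

    coreEnd : ℕ
    coreEnd = coreStart + length core

    w₁ : List A
    w₁ = factor (coreEnd ∸ length x₀) (length x₀) W

    w₂ : List A
    w₂ = factor coreStart (length x₀) W

{-# OPTIONS --safe #-}

-- Replacing one letter of a word by a different letter changes the number of
-- occurrences of that letter, while conjugate words are permutations of each
-- other.  As x₀ is primitive, x₁x₂ ≠ x₂x₁, so x₁x₂ = h c t and x₂x₁ = h c′ t′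
-- with h their longest common prefix and c ≠ c′.  Around the interrupt, W reads
-- x₂x₁ · x₁x₂ = h c′ t′ · h c t, so w₁ = t′ h c, which is the conjugate t′ h c′
-- of x₀ with one letter replaced.  Symmetrically, x₁x₂ = v c g and
-- x₂x₁ = u d g with g the longest common suffix give w₂ = d g v, to be
-- compared with c g v.

module Submission where

open import Defs
open import Algebra.Properties.CommutativeSemigroup using (xy∙z≈xz∙y)
open import Data.Fin using (Fin)
open import Data.List using (List; []; _∷_; _++_; [_]; length; take; drop; reverse)
open import Data.List.Properties
  using (++-assoc; ++-identityʳ; ++-cancelˡ; ++-monoid; length-++; length-reverse;
         reverse-++; reverse-injective; reverse-involutive; unfold-reverse; ∷-injective)
open import Data.List.Relation.Binary.Permutation.Propositional
  using (_↭_; prep; ↭-refl; ↭-trans; ↭-swap; module PermutationReasoning)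
open import Data.List.Relation.Binary.Permutation.Propositional.Properties
  using (++-comm; drop-∷; shift; ∷↭∷ʳ; ↭-length; ↭-singleton-inv)
open import Data.Nat using (ℕ; zero; suc; _+_; _∸_; _≤_; z≤n; s≤s; s≤s⁻¹)
open import Data.Nat.Properties
  using (+-assoc; +-comm; +-mono-≤; m≤n+m; ≤-refl; ≤-trans; ≤-reflexive;
         ∸-+-assoc; m+n∸n≡m; suc-injective; module ≤-Reasoning; +-commutativeSemigroup)
open import Data.Product using (_×_; _,_; ∃₂; ∃-syntax)
open import Data.Sum using (_⊎_; inj₁; inj₂)
open import Function using (_↔_; _∘_)
open import Level using (Level)
open import Relation.Binary.PropositionalEquality
  using (_≡_; _≢_; refl; sym; trans; cong; cong₂; module ≡-Reasoning)
open import Relation.Nullary using (¬_; yes; no; contradiction)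
open import Tactic.MonoidSolver using (solve)

private
  variable
    a : Level
    A : Set a

-- Powers of words, and common roots of commuting words.

^ʷ-+ : ∀ (y : List A) i j → y ^ʷ (i + j) ≡ y ^ʷ i ++ y ^ʷ j
^ʷ-+ y zero    j = refl
^ʷ-+ y (suc i) j = trans (cong (y ++_) (^ʷ-+ y i j)) (sym (++-assoc y (y ^ʷ i) (y ^ʷ j)))

^ʷ-1 : ∀ (y : List A) → y ^ʷ 1 ≡ y
^ʷ-1 = ++-identityʳ

^ʷ-sucʳ : ∀ (y : List A) n → y ^ʷ suc n ≡ y ^ʷ n ++ y
^ʷ-sucʳ y n = begin
  y ^ʷ suc n         ≡⟨ cong (y ^ʷ_) (+-comm 1 n) ⟩
  y ^ʷ (n + 1)       ≡⟨ ^ʷ-+ y n 1 ⟩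
  y ^ʷ n ++ y ^ʷ 1   ≡⟨ cong (y ^ʷ n ++_) (^ʷ-1 y) ⟩
  y ^ʷ n ++ y        ∎
  where open ≡-Reasoning

-- Here `q ++ r` and `s ++ t` stand for adjacent blocks of `W`, each cut next to a mismatch; the new
-- bracketing isolates `r ++ s`, the factor straddling their junction.
++-regroup : ∀ (p q r s t w : List A) →
             p ++ (q ++ r) ++ (s ++ t) ++ w ≡ (p ++ q) ++ (r ++ s) ++ t ++ w
++-regroup {A = A} p q r s t w = solve (++-monoid A)

++-split : ∀ (u v : List A) {w z} → u ++ w ≡ v ++ z →
           (∃[ t ] v ≡ u ++ t) ⊎ (∃[ t ] u ≡ v ++ t)
++-split []      v       _  = inj₁ (v , refl)
++-split (x ∷ u) []      _  = inj₂ (x ∷ u , refl)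
++-split (x ∷ u) (y ∷ v) eq with ∷-injective eq
... | refl , eq′ with ++-split u v eq′
...   | inj₁ (t , v≡) = inj₁ (t , cong (x ∷_) v≡)
...   | inj₂ (t , u≡) = inj₂ (t , cong (x ∷_) u≡)

-- Exponents may be 0, so that the empty word, at which the Euclidean descent stops, shares a root
-- with any word.
CommonRoot : ∀ {a} {A : Set a} → List A → List A → Set a
CommonRoot u v = ∃[ y ] ∃₂ λ i j → u ≡ y ^ʷ i × v ≡ y ^ʷ j

private
  -- Euclid's algorithm on the lengths of the two words, with fuel n.
  commuting⇒commonRoot′ : ∀ n (u v : List A) → length u + length v ≤ n →
                          u ++ v ≡ v ++ u → CommonRoot u v
  -- One subtraction: cancelling the prefix `x ∷ u` shows that `x ∷ u` commutes with `t`. The total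
  -- length drops because `x ∷ u` is non-empty, and the exponents of the root add up.
  extend : ∀ n x (u t : List A) → length (x ∷ u) + length (x ∷ u ++ t) ≤ suc n →
           (x ∷ u) ++ (x ∷ u ++ t) ≡ (x ∷ u ++ t) ++ (x ∷ u) →
           CommonRoot (x ∷ u) (x ∷ u ++ t)

  commuting⇒commonRoot′ n []      v       _ _  = v , 0 , 1 , refl , sym (^ʷ-1 v)
  commuting⇒commonRoot′ n (x ∷ u) []      _ _  = x ∷ u , 1 , 0 , sym (^ʷ-1 (x ∷ u)) , refl
  commuting⇒commonRoot′ (suc n) (x ∷ u) (y ∷ v) l eq with ++-split (x ∷ u) (y ∷ v) eq
  ... | inj₁ (t , refl) = extend n x u t l eq
  ... | inj₂ (t , refl)
    with z , i , j , p , q ← extend n y v t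
           (≤-trans (≤-reflexive (+-comm (length (y ∷ v)) (length (x ∷ u)))) l) (sym eq)
    = z , j , i , q , p

  extend n x u t l eq =
    let z , i , j , p , q = commuting⇒commonRoot′ n (x ∷ u) t shorter
          (++-cancelˡ (x ∷ u) _ _ (trans eq (++-assoc (x ∷ u) t (x ∷ u))))
    in z , i , i + j , p , trans (cong₂ _++_ p q) (sym (^ʷ-+ z i j))
    where
    open ≤-Reasoning
    shorter : length (x ∷ u) + length t ≤ n
    shorter = begin
      suc (length u + length t)        ≡⟨ cong suc (length-++ u) ⟨
      length (x ∷ u ++ t)              ≤⟨ m≤n+m _ (length u) ⟩
      length u + length (x ∷ u ++ t)   ≤⟨ s≤s⁻¹ l ⟩
      n                                ∎

commuting⇒commonRoot : ∀ (u v : List A) → u ++ v ≡ v ++ u → CommonRoot u v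
commuting⇒commonRoot u v = commuting⇒commonRoot′ _ u v ≤-refl

-- Commuting words are powers of one root. Both exponents are positive as the words are non-empty,
-- so `u ++ v` would be a power with exponent at least 2.
primitive⇒¬commuting : ∀ {u v : List A} → Primitive (u ++ v) → u ≢ [] → v ≢ [] →
                       u ++ v ≢ v ++ u
primitive⇒¬commuting {u = u} {v} prim u≢[] v≢[] eq with commuting⇒commonRoot u v eq
... | y , zero  , j     , p , q = u≢[] p
... | y , suc i , zero  , p , q = v≢[] q
... | y , suc i , suc j , p , q =
  prim y (suc i + suc j) (+-mono-≤ (s≤s (z≤n {i})) (s≤s (z≤n {j})))
    (trans (cong₂ _++_ p q) (sym (^ʷ-+ y (suc i) (suc j))))

-- Conjugacy and permutations of letters.

∈Cl⇒↭ : ∀ {x y : List A} → y ∈Cl x → y ↭ x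
∈Cl⇒↭ (inj₁ refl)                          = ↭-refl
∈Cl⇒↭ (inj₂ (u , v , _ , _ , refl , refl)) = ++-comm v u

-- The common tail is cancelled letter by letter: a swap on each side brings `x` to the front, where
-- `drop-∷` removes it.
∷-↭-head : ∀ {c d : A} xs → c ∷ xs ↭ d ∷ xs → c ≡ d
∷-↭-head []       p with refl ← ↭-singleton-inv p = refl
∷-↭-head (x ∷ xs) p =
  ∷-↭-head xs (drop-∷ (↭-trans (↭-swap x _ ↭-refl) (↭-trans p (↭-swap _ x ↭-refl))))

-- Bringing `d` to the front and exchanging `xs` with `ys` leaves the same tail `ys ++ xs` under `c`
-- and under `d`.
replaced-letter-¬↭ : ∀ {c d : A} → c ≢ d → ∀ xs ys → ¬ (c ∷ ys ++ xs ↭ xs ++ d ∷ ys)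
replaced-letter-¬↭ {d = d} c≢d xs ys p =
  c≢d (∷-↭-head (ys ++ xs) (↭-trans p (↭-trans (shift d xs ys) (prep d (++-comm xs ys)))))

-- Factors, prefixes and suffixes cut out by length.

take-length-++ : ∀ (xs ys : List A) → take (length xs) (xs ++ ys) ≡ xs
take-length-++ []       ys = refl
take-length-++ (x ∷ xs) ys = cong (x ∷_) (take-length-++ xs ys)

drop-length-++ : ∀ (xs ys : List A) → drop (length xs) (xs ++ ys) ≡ ys
drop-length-++ []       ys = refl
drop-length-++ (x ∷ xs) ys = drop-length-++ xs ys

factor-++ : ∀ (xs ys zs : List A) → factor (length xs) (length ys) (xs ++ ys ++ zs) ≡ ys
factor-++ xs ys zs =
  trans (cong (take (length ys)) (drop-length-++ xs (ys ++ zs))) (take-length-++ ys zs)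

-- The letter `c` after `h` guarantees that `take` does not run short; this gives `p̃` its full
-- length.
length-prefixOfLength : ∀ (h : List A) c t →
                        length (prefixOfLength (length h + 1) (h ++ c ∷ t)) ≡ length h + 1
length-prefixOfLength []      c t = refl
length-prefixOfLength (x ∷ h) c t = cong suc (length-prefixOfLength h c t)

suffixOfLength-++ : ∀ (xs ys : List A) → suffixOfLength (length ys) (xs ++ ys) ≡ ys
suffixOfLength-++ xs ys = trans
  (cong (λ n → drop n (xs ++ ys))
    (trans (cong (_∸ length ys) (length-++ xs)) (m+n∸n≡m (length xs) (length ys))))
  (drop-length-++ xs ys)

-- Mismatches bordering the longest common prefix and suffix.

module Mismatch {A : Set a} {k : ℕ} (A↔Fin : A ↔ Fin k) where
  open FiniteAlphabet A↔Fin

  -- Equal lengths prevent either word from being a proper prefix of the other, so distinct words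
  -- must differ at some letter right after `lcp x y`.
  lcp-mismatch : ∀ x y → length x ≡ length y → x ≢ y →
                 ∃₂ λ c d → ∃₂ λ t u →
                 c ≢ d × x ≡ lcp x y ++ c ∷ t × y ≡ lcp x y ++ d ∷ u
  lcp-mismatch []      []      _ x≢y = contradiction refl x≢y
  lcp-mismatch (c ∷ x) (d ∷ y) l x≢y with c ≟ d
  ... | no  c≢d  = c , d , x , y , c≢d , refl , refl
  ... | yes refl
    with c′ , d′ , t , u , c′≢d′ , p , q ←
           lcp-mismatch x y (suc-injective l) (x≢y ∘ cong (c ∷_))
    = c′ , d′ , t , u , c′≢d′ , cong (c ∷_) p , cong (c ∷_) q

  private
    reverse-≡-++-∷ : ∀ (x : List A) h c t → reverse x ≡ h ++ c ∷ t →
                     x ≡ reverse t ++ c ∷ reverse h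
    reverse-≡-++-∷ x h c t eq = begin
      x                                ≡⟨ reverse-involutive x ⟨
      reverse (reverse x)              ≡⟨ cong reverse eq ⟩
      reverse (h ++ c ∷ t)             ≡⟨ reverse-++ h (c ∷ t) ⟩
      reverse (c ∷ t) ++ reverse h     ≡⟨ cong (_++ reverse h) (unfold-reverse c t) ⟩
      (reverse t ++ [ c ]) ++ reverse h ≡⟨ ++-assoc (reverse t) [ c ] (reverse h) ⟩
      reverse t ++ c ∷ reverse h       ∎
      where open ≡-Reasoning

  lcs-mismatch : ∀ x y → length x ≡ length y → x ≢ y →
                 ∃₂ λ c d → ∃₂ λ t u →
                 c ≢ d × x ≡ t ++ c ∷ lcs x y × y ≡ u ++ d ∷ lcs x y
  lcs-mismatch x y l x≢y
    with c , d , t , u , c≢d , p , q ←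
           lcp-mismatch (reverse x) (reverse y)
             (trans (length-reverse x) (trans l (sym (length-reverse y))))
             (x≢y ∘ reverse-injective)
    = c , d , reverse t , reverse u , c≢d
    , reverse-≡-++-∷ x _ c t p , reverse-≡-++-∷ y _ d u q

  -- Positions of the core, `w₁` and `w₂` inside `W`.

  module _ (x₁ x₂ : List A) (m n : ℕ)
           (prim : Primitive (x₁ ++ x₂)) (x₁≢[] : x₁ ≢ []) (x₂≢[] : x₂ ≢ []) where

    open Interrupt (x₁ ++ x₂) x₁ x₂ (suc m) (suc n)

    private
      -- Successor exponents expose one copy of `x₀` on each side of the interrupt. The left copy
      -- followed by `x₁` reads `x₁ x₂ x₁`; its first `x₁` goes into `before`, leaving the conjugate
      -- `x₂ ++ x₁`.
      x₀ before after : List A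
      x₀     = x₁ ++ x₂
      before = x₀ ^ʷ m ++ x₁
      after  = x₀ ^ʷ n

      |x₁x₂|≡|x₂x₁| : length (x₁ ++ x₂) ≡ length (x₂ ++ x₁)
      |x₁x₂|≡|x₂x₁| =
        trans (length-++ x₁) (trans (+-comm (length x₁) (length x₂)) (sym (length-++ x₂)))

      x₁x₂≢x₂x₁ : x₁ ++ x₂ ≢ x₂ ++ x₁
      x₁x₂≢x₂x₁ = primitive⇒¬commuting prim x₁≢[] x₂≢[]

      beforeInterrupt : x₀ ^ʷ suc m ++ x₁ ≡ before ++ x₂ ++ x₁
      beforeInterrupt = begin
        x₀ ^ʷ suc m ++ x₁            ≡⟨ cong (_++ x₁) (^ʷ-sucʳ x₀ m) ⟩
        (x₀ ^ʷ m ++ x₁ ++ x₂) ++ x₁  ≡⟨ cong (_++ x₁) (++-assoc (x₀ ^ʷ m) x₁ x₂) ⟨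
        (before ++ x₂) ++ x₁         ≡⟨ ++-assoc before x₂ x₁ ⟩
        before ++ x₂ ++ x₁           ∎
        where open ≡-Reasoning

      -- The junction of `x₂ ++ x₁` with `x₁ ++ x₂` is where `s̃` ends and `p̃` begins.
      W≡ : W ≡ before ++ (x₂ ++ x₁) ++ (x₁ ++ x₂) ++ after
      W≡ = begin
        x₀ ^ʷ suc m ++ x₁ ++ x₀ ++ after        ≡⟨ ++-assoc (x₀ ^ʷ suc m) x₁ _ ⟨
        (x₀ ^ʷ suc m ++ x₁) ++ x₀ ++ after      ≡⟨ cong (_++ x₀ ++ after) beforeInterrupt ⟩
        (before ++ x₂ ++ x₁) ++ x₀ ++ after     ≡⟨ ++-assoc before (x₂ ++ x₁) _ ⟩
        before ++ (x₂ ++ x₁) ++ x₀ ++ after     ∎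
        where open ≡-Reasoning

      -- The part of `W` before the junction ends in `d ∷ lcs`, exactly the letters subtracted in
      -- `coreStart`, so no subtraction is truncated.
      coreStart-suffix : ∀ {u d} → x₂ ++ x₁ ≡ u ++ d ∷ lcs (x₁ ++ x₂) (x₂ ++ x₁) →
                         coreStart ≡ length (before ++ u)
      coreStart-suffix {u} {d} eq = begin
        length (x₀ ^ʷ suc m) + length x₁ ∸ length g ∸ 1
          ≡⟨ ∸-+-assoc _ (length g) 1 ⟩
        length (x₀ ^ʷ suc m) + length x₁ ∸ (length g + 1)
          ≡⟨ cong (_∸ (length g + 1)) (sym (length-++ (x₀ ^ʷ suc m))) ⟩
        length (x₀ ^ʷ suc m ++ x₁) ∸ (length g + 1)
          ≡⟨ cong (λ z → length z ∸ (length g + 1)) (trans beforeInterrupt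
               (trans (cong (before ++_) eq) (sym (++-assoc before u (d ∷ g))))) ⟩
        length ((before ++ u) ++ d ∷ g) ∸ (length g + 1)
          ≡⟨ cong₂ _∸_ (length-++ (before ++ u)) (+-comm (length g) 1) ⟩
        length (before ++ u) + suc (length g) ∸ suc (length g)
          ≡⟨ m+n∸n≡m (length (before ++ u)) (suc (length g)) ⟩
        length (before ++ u) ∎
        where
        open ≡-Reasoning
        g = lcs (x₁ ++ x₂) (x₂ ++ x₁)

      length-s̃ : ∀ {u d} → x₂ ++ x₁ ≡ u ++ d ∷ lcs (x₁ ++ x₂) (x₂ ++ x₁) →
                 length s̃ ≡ suc (length (lcs (x₁ ++ x₂) (x₂ ++ x₁)))
      length-s̃ {u} {d} eq = cong length (trans
        (cong₂ suffixOfLength (+-comm (length g) 1) eq)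
        (suffixOfLength-++ u (d ∷ g)))
        where g = lcs (x₁ ++ x₂) (x₂ ++ x₁)

      length-p̃ : ∀ {c t} → x₁ ++ x₂ ≡ lcp (x₁ ++ x₂) (x₂ ++ x₁) ++ c ∷ t →
                 length p̃ ≡ length (lcp (x₁ ++ x₂) (x₂ ++ x₁)) + 1
      length-p̃ {c} {t} eq = trans
        (cong (λ z → length (prefixOfLength (length h + 1) z)) eq)
        (length-prefixOfLength h c t)
        where h = lcp (x₁ ++ x₂) (x₂ ++ x₁)

      -- Starting at `d`, the factor takes the common suffix up to the junction and then `v`; its
      -- length is exhausted just before `c`.
      w₂≡ : ∀ {c d v u} → x₁ ++ x₂ ≡ v ++ c ∷ lcs (x₁ ++ x₂) (x₂ ++ x₁) →
            x₂ ++ x₁ ≡ u ++ d ∷ lcs (x₁ ++ x₂) (x₂ ++ x₁) →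
            w₂ ≡ d ∷ lcs (x₁ ++ x₂) (x₂ ++ x₁) ++ v
      w₂≡ {c} {d} {v} {u} p q = begin
        factor coreStart (length x₀) W
          ≡⟨ cong₂ (λ i l → factor i l W) (coreStart-suffix q) |x₀|≡ ⟩
        factor (length (before ++ u)) (length (d ∷ g ++ v)) W
          ≡⟨ cong (factor (length (before ++ u)) (length (d ∷ g ++ v))) regroup ⟩
        factor (length (before ++ u)) (length (d ∷ g ++ v))
               ((before ++ u) ++ (d ∷ g ++ v) ++ c ∷ g ++ after)
          ≡⟨ factor-++ (before ++ u) (d ∷ g ++ v) (c ∷ g ++ after) ⟩
        d ∷ g ++ v ∎
        where
        open ≡-Reasoning
        g = lcs (x₁ ++ x₂) (x₂ ++ x₁)

        |x₀|≡ : length x₀ ≡ length (d ∷ g ++ v)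
        -- Rotation gives `c ∷ g ++ v`, whose length agrees definitionally with that of
        -- `d ∷ g ++ v`.
        |x₀|≡ = trans (cong length p) (↭-length (++-comm v (c ∷ g)))

        regroup : W ≡ (before ++ u) ++ (d ∷ g ++ v) ++ c ∷ g ++ after
        regroup = begin
          W
            ≡⟨ W≡ ⟩
          before ++ (x₂ ++ x₁) ++ (x₁ ++ x₂) ++ after
            ≡⟨ cong₂ (λ y z → before ++ y ++ z ++ after) q p ⟩
          before ++ (u ++ d ∷ g) ++ (v ++ c ∷ g) ++ after
            ≡⟨ ++-regroup before u (d ∷ g) v (c ∷ g) after ⟩
          (before ++ u) ++ (d ∷ g ++ v) ++ c ∷ g ++ after ∎

      -- The length of `s̃` cancels the distance from `coreStart` to the junction, so the core ends
      -- `length p̃` letters beyond it.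
      coreEnd≡ : ∀ {c d t u} → x₁ ++ x₂ ≡ lcp (x₁ ++ x₂) (x₂ ++ x₁) ++ c ∷ t →
                 x₂ ++ x₁ ≡ u ++ d ∷ lcs (x₁ ++ x₂) (x₂ ++ x₁) →
                 coreEnd ≡ length before + length x₀ + (length (lcp (x₁ ++ x₂) (x₂ ++ x₁)) + 1)
      coreEnd≡ {c} {d} {t} {u} p q = begin
        coreStart + length core
          ≡⟨ cong₂ _+_ (coreStart-suffix q)
               (trans (length-++ s̃) (cong₂ _+_ (length-s̃ q) (length-p̃ p))) ⟩
        length (before ++ u) + (suc (length g) + l)
          ≡⟨ +-assoc (length (before ++ u)) (suc (length g)) l ⟨
        length (before ++ u) + suc (length g) + l
          ≡⟨ cong (_+ l) (length-++ (before ++ u)) ⟨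
        length ((before ++ u) ++ d ∷ g) + l
          ≡⟨ cong (λ z → length z + l) (trans (++-assoc before u (d ∷ g)) (cong (before ++_) (sym q))) ⟩
        length (before ++ x₂ ++ x₁) + l
          ≡⟨ cong (_+ l) (trans (length-++ before) (cong (length before +_) (sym |x₁x₂|≡|x₂x₁|))) ⟩
        length before + length x₀ + l ∎
        where
        open ≡-Reasoning
        g = lcs (x₁ ++ x₂) (x₂ ++ x₁)
        l = length (lcp (x₁ ++ x₂) (x₂ ++ x₁)) + 1

      -- Both blocks have length `length x₀`, so going back that far from just after `c` in
      -- `x₁ ++ x₂` lands just after `d` in `x₂ ++ x₁`. What lies between is the rest `t′` of the
      -- first block, then `lcp` and `c`.
      w₁≡ : ∀ {c d d′ t u t′} → x₁ ++ x₂ ≡ lcp (x₁ ++ x₂) (x₂ ++ x₁) ++ c ∷ t →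
            x₂ ++ x₁ ≡ lcp (x₁ ++ x₂) (x₂ ++ x₁) ++ d ∷ t′ →
            x₂ ++ x₁ ≡ u ++ d′ ∷ lcs (x₁ ++ x₂) (x₂ ++ x₁) →
            w₁ ≡ t′ ++ lcp (x₁ ++ x₂) (x₂ ++ x₁) ++ [ c ]
      w₁≡ {c} {d} {t = t} {t′ = t′} p q r = begin
        factor (coreEnd ∸ length x₀) (length x₀) W
          ≡⟨ cong₂ (λ i l → factor i l W) start≡ |x₀|≡ ⟩
        factor (length (before ++ h ++ [ d ])) (length (t′ ++ h ++ [ c ])) W
          ≡⟨ cong (factor (length (before ++ h ++ [ d ])) (length (t′ ++ h ++ [ c ]))) regroup ⟩
        factor (length (before ++ h ++ [ d ])) (length (t′ ++ h ++ [ c ]))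
               ((before ++ h ++ [ d ]) ++ (t′ ++ h ++ [ c ]) ++ t ++ after)
          ≡⟨ factor-++ (before ++ h ++ [ d ]) (t′ ++ h ++ [ c ]) (t ++ after) ⟩
        t′ ++ h ++ [ c ] ∎
        where
        open ≡-Reasoning
        h = lcp (x₁ ++ x₂) (x₂ ++ x₁)

        start≡ : coreEnd ∸ length x₀ ≡ length (before ++ h ++ [ d ])
        start≡ = begin
          coreEnd ∸ length x₀
            ≡⟨ cong (_∸ length x₀) (coreEnd≡ p r) ⟩
          length before + length x₀ + (length h + 1) ∸ length x₀
            ≡⟨ cong (_∸ length x₀)
                 (xy∙z≈xz∙y +-commutativeSemigroup (length before) (length x₀) (length h + 1)) ⟩
          length before + (length h + 1) + length x₀ ∸ length x₀
            ≡⟨ m+n∸n≡m (length before + (length h + 1)) (length x₀) ⟩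
          length before + (length h + 1)
            ≡⟨ cong (length before +_) (length-++ h) ⟨
          length before + length (h ++ [ d ])
            ≡⟨ length-++ before ⟨
          length (before ++ h ++ [ d ]) ∎

        |x₀|≡ : length x₀ ≡ length (t′ ++ h ++ [ c ])
        |x₀|≡ = begin
          length x₀                  ≡⟨ |x₁x₂|≡|x₂x₁| ⟩
          length (x₂ ++ x₁)          ≡⟨ cong length q ⟩
          length (h ++ d ∷ t′)       ≡⟨ cong length (++-assoc h [ d ] t′) ⟨
          length ((h ++ [ d ]) ++ t′) ≡⟨ ↭-length (++-comm (h ++ [ d ]) t′) ⟩
          length (t′ ++ h ++ [ d ])  ≡⟨ length-++ t′ ⟩
          length t′ + length (h ++ [ d ])
            ≡⟨ cong (length t′ +_) (trans (length-++ h) (sym (length-++ h))) ⟩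
          length t′ + length (h ++ [ c ]) ≡⟨ length-++ t′ ⟨
          length (t′ ++ h ++ [ c ])  ∎

        regroup : W ≡ (before ++ h ++ [ d ]) ++ (t′ ++ h ++ [ c ]) ++ t ++ after
        regroup = begin
          W
            ≡⟨ W≡ ⟩
          before ++ (x₂ ++ x₁) ++ (x₁ ++ x₂) ++ after
            ≡⟨ cong₂ (λ y z → before ++ y ++ z ++ after)
                 (trans q (sym (++-assoc h [ d ] t′))) (trans p (sym (++-assoc h [ c ] t))) ⟩
          before ++ ((h ++ [ d ]) ++ t′) ++ ((h ++ [ c ]) ++ t) ++ after
            ≡⟨ ++-regroup before (h ++ [ d ]) t′ (h ++ [ c ]) t after ⟩
          (before ++ h ++ [ d ]) ++ (t′ ++ h ++ [ c ]) ++ t ++ after ∎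

    -- Comparison of `w₁` and `w₂` with conjugates of `x₀`.

    w₁∉Cl : ¬ (w₁ ∈Cl x₁ ++ x₂)
    w₁∉Cl w₁∈Cl
      with c , d , t , t′ , c≢d , p , q ←
             lcp-mismatch (x₁ ++ x₂) (x₂ ++ x₁) |x₁x₂|≡|x₂x₁| x₁x₂≢x₂x₁
      -- The suffix decomposition is needed to locate the end of the core, which is counted from the
      -- start of `s̃`.
      with _ , _ , _ , _ , _ , _ , r ←
             lcs-mismatch (x₁ ++ x₂) (x₂ ++ x₁) |x₁x₂|≡|x₂x₁| x₁x₂≢x₂x₁
      = replaced-letter-¬↭ c≢d h t′ (begin
          c ∷ t′ ++ h        ↭⟨ ∷↭∷ʳ c (t′ ++ h) ⟩
          (t′ ++ h) ++ [ c ] ≡⟨ ++-assoc t′ h [ c ] ⟩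
          t′ ++ h ++ [ c ]   ≡⟨ w₁≡ p q r ⟨
          w₁                 ↭⟨ ∈Cl⇒↭ w₁∈Cl ⟩
          -- The letter `d` to be replaced sits in the decomposition of `x₂ ++ x₁`, so the chain
          -- passes to that conjugate.
          x₁ ++ x₂           ↭⟨ ++-comm x₁ x₂ ⟩
          x₂ ++ x₁           ≡⟨ q ⟩
          h ++ d ∷ t′        ∎)
      where
      open PermutationReasoning
      h = lcp (x₁ ++ x₂) (x₂ ++ x₁)

    w₂∉Cl : ¬ (w₂ ∈Cl x₁ ++ x₂)
    w₂∉Cl w₂∈Cl
      with c , d , v , u , c≢d , p , q ←
             lcs-mismatch (x₁ ++ x₂) (x₂ ++ x₁) |x₁x₂|≡|x₂x₁| x₁x₂≢x₂x₁
      -- The roles are exchanged here: `d`, from `x₂ ++ x₁`, takes the place of the letter `c` of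
      -- `x₁ ++ x₂`.
      = replaced-letter-¬↭ (c≢d ∘ sym) v g (begin
          d ∷ g ++ v   ≡⟨ w₂≡ p q ⟨
          w₂           ↭⟨ ∈Cl⇒↭ w₂∈Cl ⟩
          x₁ ++ x₂     ≡⟨ p ⟩
          v ++ c ∷ g   ∎)
      where
      open PermutationReasoning
      g = lcs (x₁ ++ x₂) (x₂ ++ x₁)

theorem2p5 : ∀ {a} {A : Set a} {k : ℕ} (A↔Fin : A ↔ Fin k)
    (x₀ x₁ x₂ : List A) (e₁ e₂ : ℕ) →
    Primitive x₀ →
    x₀ ≡ x₁ ++ x₂ → x₁ ≢ [] → x₂ ≢ [] →
    1 ≤ e₁ → 1 ≤ e₂ → 3 ≤ e₁ + e₂ →
    let open FiniteAlphabet.Interrupt A↔Fin x₀ x₁ x₂ e₁ e₂ in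
    ¬ (w₁ ∈Cl x₀) × ¬ (w₂ ∈Cl x₀)
theorem2p5 A↔Fin _ x₁ x₂ (suc m) (suc n) prim refl x₁≢[] x₂≢[] _ _ _ =
  w₁∉Cl x₁ x₂ m n prim x₁≢[] x₂≢[] , w₂∉Cl x₁ x₂ m n prim x₁≢[] x₂≢[]
  where open Mismatch A↔Fin
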